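{- Let $n\geq 2$ and let $S_n$ be either $\Sigma_n$ or $\Sigma_n^{*}$. Let $\ell\geq 2$ be an integer. Let $W_{\ell-1}$ and $W_{\ell-2}$ be sets of $S_n$-words representing $B_n(S_n,\ell-1)$ and $B_n(S_n,\ell-2)$ respectively, where each word $u\in W_{\ell-1}$ carries the integer label $u\cdot\omega=\omega_{S_n}(\overline{u})$. Run on $W_{\ell-1}$ and $W_{\ell-2}$, the algorithm RepSet returns a set $W_\ell$ representing $B_n(S_n,\ell)$. Moreover, for every $u\in W_\ell$, the value of the label $u\cdot\omega$ upon return is the integer $\omega_{S_n}(\overline{u})$.
   Context: $B_n$ is the braid group, generated by $\sigma_1,\ldots,\sigma_{n-1}$ subject to $\sigma_i\sigma_j=\sigma_j\sigma_i$ for $|i-j|\geq 2$ and $\sigma_i\sigma_j\sigma_i=\sigma_j\sigma_i\sigma_j$ for $|i-j|=1$. Put $\Sigma_n=\{\sigma_i^{\pm1} : 1\leq i\leq n-1\}$. For $1\leq p<q\leq n$ put $a_{p,q}=\sigma_p\cdots\sigma_{q-2}\,\sigma_{q-1}\,\sigma_{q-2}^{ -1}\cdots\sigma_p^{ -1}$, and $\Sigma_n^{*}=\{a_{p,q}^{\pm1} : 1\leq p<q\leq n\}$. An $S_n$-word is a finite word on the alphabet $S_n$; $|u|$ is the length of the word $u$, $\overline{u}$ is the braid it represents, and $u\equiv v$ (equivalence) means $\overline{u}=\overline{v}$. The $S_n$-length $|\beta|_{S_n}$ of a braid $\beta$ is the length of a shortest $S_n$-word representing $\beta$; a word $u$ is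 geodesic if $|u|=|\overline{u}|_{S_n}$. $B_n(S_n,\ell)$ is the set of braids of $B_n$ of $S_n$-length $\ell$. $\omega_{S_n}(\beta)$ is the number of geodesic $S_n$-words representing $\beta$. A set $W$ of $S_n$-words represents a subset $X\subseteq B_n$ if $W$ is a set of unique geodesic representatives for $X$: every word of $W$ is geodesic and $u\mapsto\overline{u}$ is a bijection from $W$ to $X$. Algorithm RepSet, with input $(W_{\ell-1},W_{\ell-2})$: start with $W_\ell=\emptyset$. For each $x\in S_n$ and, for each such $x$, for each $u\in W_{\ell-1}$ (in any order), let $v=ux$. If $v$ is not equivalent to any word of $W_{\ell-2}$, then do the following: if $v$ is not equivalent to any word of the current set $W_\ell$, add $v$ to $W_\ell$ and set its label $v\cdot\omega:=u\cdot\omega$; otherwise let $w$ be the word of $W_\ell$ equivalent to $v$ and replace its label $w\cdot\omega$ by $w\cdot\omega+u\cdot\omega$. After both loops, return $W_\ell$ (with its labels). -}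

module Defs where

open import Algebra.Bundles using (Group)
open import Data.Fin using (Fin; zero; suc; toℕ)
open import Data.List using (List; []; _∷_; [_]; _∷ʳ_; _++_; length; map; foldr; foldl; filter; reverse; allFin)
open import Data.List.Membership.Propositional using (_∈_)
open import Data.List.Relation.Binary.Permutation.Propositional using (_↭_)
open import Data.List.Relation.Unary.All using (All)
open import Data.List.Relation.Unary.Any using (any?)
open import Data.List.Relation.Unary.Unique.Propositional using (Unique)
open import Data.Nat using (ℕ; pred; suc; _+_; _≤_; _<_; _≤?_; _<?_; ∣_-_∣)
open import Data.Product using (_×_; _,_; proj₁; ∃-syntax)
open import Data.Sign using (Sign)
open import Function.Bundles using (_⇔_)
open import Level using (0ℓ)
open import Relation.Binary.Definitions using (Decidable)
open import Relation.Binary.PropositionalEquality using (_≡_)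
open import Relation.Nullary using (yes; no)
open import Relation.Nullary.Decidable using (_×-dec_)
open import Relation.Unary using (Pred)

infix  4 _≈_ _≋_
infixl 7 _∙_
infix  8 _⁻¹ _^±_

-- The group presented by generators and relations: group terms modulo the
-- congruence _≈_ generated by the group axioms and the braid relations.
-- Indices are 0-based: σ i stands for the generator σ_{i+1}.

data Braid (n : ℕ) : Set where
  σ    : Fin (pred n) → Braid n
  ε    : Braid n
  _∙_  : Braid n → Braid n → Braid n
  _⁻¹  : Braid n → Braid n

data _≈_ {n : ℕ} : Braid n → Braid n → Set where
  ≈-refl    : ∀ {x} → x ≈ x
  ≈-sym     : ∀ {x y} → x ≈ y → y ≈ x
  ≈-trans   : ∀ {x y z} → x ≈ y → y ≈ z → x ≈ z
  ∙-cong    : ∀ {x x′ y y′} → x ≈ x′ → y ≈ y′ → x ∙ y ≈ x′ ∙ y′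
  ⁻¹-cong   : ∀ {x y} → x ≈ y → x ⁻¹ ≈ y ⁻¹
  assoc     : ∀ x y z → (x ∙ y) ∙ z ≈ x ∙ (y ∙ z)
  identityˡ : ∀ x → ε ∙ x ≈ x
  identityʳ : ∀ x → x ∙ ε ≈ x
  inverseˡ  : ∀ x → x ⁻¹ ∙ x ≈ ε
  inverseʳ  : ∀ x → x ∙ x ⁻¹ ≈ ε
  far       : ∀ i j → 2 ≤ ∣ toℕ i - toℕ j ∣ → σ i ∙ σ j ≈ σ j ∙ σ i
  near      : ∀ i j → ∣ toℕ i - toℕ j ∣ ≡ 1 → σ i ∙ σ j ∙ σ i ≈ σ j ∙ σ i ∙ σ j

braidGroup : ℕ → Group 0ℓ 0ℓ
braidGroup n = record
  { Carrier = Braid n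
  ; _≈_     = _≈_
  ; _∙_     = _∙_
  ; ε       = ε
  ; _⁻¹     = _⁻¹
  ; isGroup = record
    { isMonoid = record
      { isSemigroup = record
        { isMagma = record
          { isEquivalence = record { refl = ≈-refl ; sym = ≈-sym ; trans = ≈-trans }
          ; ∙-cong        = ∙-cong
          }
        ; assoc = assoc
        }
      ; identity = identityˡ , identityʳ
      }
    ; inverse = inverseˡ , inverseʳ
    ; ⁻¹-cong = ⁻¹-cong
    }
  }

_^±_ : ∀ {n} → Braid n → Sign → Braid n
x ^± Sign.+ = x
x ^± Sign.- = x ⁻¹

∏ : ∀ {n} → List (Braid n) → Braid n
∏ = foldr _∙_ ε

-- a p q is σ_p ⋯ σ_{q-2} · σ_{q-1} · σ_{q-2}⁻¹ ⋯ σ_p⁻¹.  The formula is the same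
-- for 0-based indices; in the only possible case q = suc r, the middle factor is
-- σ r and `between` lists the indices i with p ≤ i ≤ q-2 in increasing order.
a : ∀ {n} (p q : Fin n) → .(toℕ p < toℕ q) → Braid n
a {suc m} p zero ()
a {suc m} p (suc r) _ =
  ∏ (map σ between) ∙ σ r ∙ ∏ (map (λ i → σ i ⁻¹) (reverse between))
  where
  between : List (Fin m)
  between = filter (λ i → (toℕ p ≤? toℕ i) ×-dec (toℕ i <? toℕ r)) (allFin m)

-- `artin` selects Σ_n and `dual` selects Σ_n*.
data GeneratingSet : Set where
  artin dual : GeneratingSet

-- The strictness proof is irrelevant, so a letter is determined by p, q and its sign.
data Letter : GeneratingSet → ℕ → Set where
  σ± : ∀ {n} → Fin (pred n) → Sign → Letter artin n
  a± : ∀ {n} (p q : Fin n) → .(toℕ p < toℕ q) → Sign → Letter dual n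

letterBraid : ∀ {S n} → Letter S n → Braid n
letterBraid (σ± i s)       = σ i ^± s
letterBraid (a± p q p<q s) = a p q p<q ^± s

Word : GeneratingSet → ℕ → Set
Word S n = List (Letter S n)

⟦_⟧ : ∀ {S n} → Word S n → Braid n
⟦ u ⟧ = ∏ (map letterBraid u)

_≋_ : ∀ {S n} → Word S n → Word S n → Set
u ≋ v = ⟦ u ⟧ ≈ ⟦ v ⟧

-- HasLength S β ℓ says |β|_S = ℓ; it is a relation because a minimum over
-- representing words is not a constructively total function.
HasLength : ∀ {n} → GeneratingSet → Braid n → ℕ → Set
HasLength {n} S β ℓ =
  (∃[ u ] ⟦_⟧ {S} {n} u ≈ β × length u ≡ ℓ) ×
  (∀ (u : Word S n) → ⟦ u ⟧ ≈ β → ℓ ≤ length u)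

Geodesic : ∀ {S n} → Word S n → Set
Geodesic {S} u = HasLength S ⟦ u ⟧ (length u)

Sphere : (n : ℕ) → GeneratingSet → ℕ → Pred (Braid n) 0ℓ
Sphere n S ℓ β = HasLength S β ℓ

-- HasGeodesicCount S β k says ω_S(β) = k.
HasGeodesicCount : ∀ {n} → GeneratingSet → Braid n → ℕ → Set
HasGeodesicCount {n} S β k =
  ∃[ ws ] Unique ws
        × (∀ (w : Word S n) → w ∈ ws ⇔ (Geodesic w × ⟦ w ⟧ ≈ β))
        × length ws ≡ k

-- Finite sets of words are lists without repetition.  The last three fields say
-- that u ↦ ⟦ u ⟧ is a bijection onto X, elements of X being compared by _≈_.
record Represents {S n} (W : List (Word S n)) (X : Pred (Braid n) 0ℓ) : Set where
  field
    unique     : Unique W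
    geodesic   : ∀ {u} → u ∈ W → Geodesic u
    into       : ∀ {u} → u ∈ W → X ⟦ u ⟧
    injective  : ∀ {u v} → u ∈ W → v ∈ W → u ≋ v → u ≡ v
    surjective : ∀ {β} → X β → ∃[ u ] u ∈ W × ⟦ u ⟧ ≈ β

LabelledWord : GeneratingSet → ℕ → Set
LabelledWord S n = Word S n × ℕ

words : ∀ {S n} → List (LabelledWord S n) → List (Word S n)
words = map proj₁

CorrectLabel : ∀ {S n} → LabelledWord S n → Set
CorrectLabel {S} (u , k) = HasGeodesicCount S ⟦ u ⟧ k

-- An order of execution of the two nested loops: the letters are visited in the
-- order `letters`, and during the visit of x the labelled words of W are visited
-- in the order `inner x`, which may depend on x.
record LoopOrder {S n} (W : List (LabelledWord S n)) : Set where
  field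
    letters          : List (Letter S n)
    letters-unique   : Unique letters
    letters-complete : ∀ x → x ∈ letters
    inner            : Letter S n → List (LabelledWord S n)
    inner-↭          : ∀ x → inner x ↭ W

-- The algorithm tests words for equivalence, so it takes as a parameter an
-- arbitrary procedure deciding equality in the braid group.
module Algorithm {S : GeneratingSet} {n : ℕ} (_≈?_ : Decidable (_≈_ {n})) where

  -- If some word of the list is equivalent to v, add k to its label; otherwise
  -- add v with label k.
  record-word : Word S n → ℕ → List (LabelledWord S n) → List (LabelledWord S n)
  record-word v k [] = [ (v , k) ]
  record-word v k ((w , m) ∷ W) with ⟦ v ⟧ ≈? ⟦ w ⟧
  ... | yes _ = (w , m + k) ∷ W
  ... | no  _ = (w , m) ∷ record-word v k W

  body : List (Word S n) → Letter S n →
         List (LabelledWord S n) → LabelledWord S n → List (LabelledWord S n)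
  body W₂ x W (u , k) with any? (λ w → ⟦ u ∷ʳ x ⟧ ≈? ⟦ w ⟧) W₂
  ... | yes _ = W
  ... | no  _ = record-word (u ∷ʳ x) k W

  -- W₁ and W₂ are the inputs W_{ℓ-1} and W_{ℓ-2}.
  RepSet : (W₁ : List (LabelledWord S n)) (W₂ : List (Word S n)) →
           LoopOrder W₁ → List (LabelledWord S n)
  RepSet W₁ W₂ order = foldl (λ W x → foldl (body W₂ x) W (inner x)) [] letters
    where open LoopOrder order

open Algorithm public using (RepSet)

{-# OPTIONS --safe #-}

-- The relations of the braid group preserve the parity of words, and every letter is
-- odd, so appending a letter to a geodesic word of length ℓ-1 yields a braid of length
-- ℓ-2 or ℓ, never ℓ-1.  Discarding the words equivalent to a word of W_{ℓ-2} therefore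
-- leaves exactly the braids of length ℓ.  Moreover every geodesic word of length ℓ is
-- uniquely a geodesic word of length ℓ-1 followed by a letter, so the geodesic words
-- of a braid β split according to the pairs (x, u) for which u x represents β.

module Submission where

open import Defs
open import Data.Empty using (⊥-elim)
open import Data.Fin using (Fin; suc; toℕ)
open import Data.List
  using (List; []; _∷_; _∷ʳ_; _++_; _ʳ++_; allFin; concatMap; filter; foldl;
         initLast; _∷ʳ′_; length; map; reverse)
open import Data.List.Membership.Propositional using (_∈_; find; lose)
open import Data.List.Membership.Propositional.Properties
  using (∈-map⁺; ∈-map⁻; ∈-++⁺ˡ; ∈-++⁺ʳ; ∈-++⁻; ∈-concatMap⁺; ∈-concatMap⁻)
open import Data.List.Properties
  using (foldl-++; foldl-cong; foldl-map; length-++; length-++-sucʳ; length-map; length-reverse;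
         ++-identityʳ; ∷ʳ-injective; ∷ʳ-injectiveˡ)
open import Data.List.Relation.Binary.Permutation.Propositional using (_↭_; ↭-sym; ↭⇒↭ₛ)
open import Data.List.Relation.Binary.Permutation.Propositional.Properties using (∈-resp-↭)
import Data.List.Relation.Binary.Permutation.Setoid.Properties as Permutationₛ
open import Data.List.Relation.Unary.All as All using (All; []; _∷_)
import Data.List.Relation.Unary.All.Properties as All
open import Data.List.Relation.Unary.AllPairs as AllPairs using (AllPairs; []; _∷_)
import Data.List.Relation.Unary.AllPairs.Properties as AllPairs
open import Data.List.Relation.Unary.Any as Any using (Any; any?; here; there)
import Data.List.Relation.Unary.Any.Properties as Any
open import Data.List.Relation.Unary.Unique.Propositional using (Unique)
import Data.List.Relation.Unary.Unique.Propositional.Properties as Unique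
open import Data.Nat.Base as ℕ using (ℕ; suc; parity; _≤_; _∸_; s≤s; s≤s⁻¹)
open import Data.Nat.Properties
  using (_≤?_; _<?_; ≤-antisym; ≤-reflexive; ≤-trans; m≤n⇒m<n∨m≡n; 1+n≰n; n≤1+n; suc-injective)
open import Data.Parity.Base as ℙ using (Parity; 0ℙ; 1ℙ)
import Data.Parity.Properties as ℙ
open import Data.Product using (_×_; _,_; proj₁; proj₂; ∃-syntax)
open import Data.Sign as Sign using (Sign)
open import Data.Sum using (_⊎_; inj₁; inj₂; [_,_]′)
open import Function using (_∘_; _⇔_; mk⇔; Equivalence)
open import Level using (0ℓ)
open import Relation.Binary.Core using (Rel)
open import Relation.Binary.Definitions using (Decidable; Symmetric)
open import Relation.Binary.PropositionalEquality
  using (_≡_; refl; sym; trans; cong; cong₂; subst; resp₂; setoid; module ≡-Reasoning)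
open import Relation.Nullary using (¬_; yes; no)
open import Relation.Nullary.Decidable using (_×-dec_)
open import Relation.Unary using (Pred)

open Equivalence using (to; from)

-- Lists and finite cardinalities

module _ {A : Set} where

  AllPairs-map-∈ : ∀ {R Q : Rel A 0ℓ} {xs} →
    (∀ {x y} → x ∈ xs → y ∈ xs → R x y → Q x y) → AllPairs R xs → AllPairs Q xs
  AllPairs-map-∈ f []       = []
  AllPairs-map-∈ f (r ∷ rs) =
    All.tabulate (λ y∈ → f (here refl) (there y∈) (All.lookup r y∈)) ∷
    AllPairs-map-∈ (λ x∈ y∈ → f (there x∈) (there y∈)) rs

  AllPairs-¬⇒≡ : ∀ {R : Rel A 0ℓ} {xs x y} → Symmetric R → AllPairs (λ x y → ¬ R x y) xs →
    x ∈ xs → y ∈ xs → R x y → x ≡ y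
  AllPairs-¬⇒≡ R-sym (r ∷ rs) (here refl) (here refl) Rxy = refl
  AllPairs-¬⇒≡ R-sym (r ∷ rs) (here refl) (there y∈)  Rxy = ⊥-elim (All.lookup r y∈ Rxy)
  AllPairs-¬⇒≡ R-sym (r ∷ rs) (there x∈)  (here refl) Rxy = ⊥-elim (All.lookup r x∈ (R-sym Rxy))
  AllPairs-¬⇒≡ R-sym (r ∷ rs) (there x∈)  (there y∈)  Rxy = AllPairs-¬⇒≡ R-sym rs x∈ y∈ Rxy

  AllPairs-resp-↭ : ∀ {R : Rel A 0ℓ} {xs ys} → Symmetric R → xs ↭ ys → AllPairs R xs → AllPairs R ys
  AllPairs-resp-↭ {R} R-sym p = Permutationₛ.AllPairs-resp-↭ (setoid A) R-sym (resp₂ R) (↭⇒↭ₛ p)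

  -- Flattens nested loops into one, so that a single invariant can be carried through the whole
  -- run.
  foldl-concatMap : ∀ {B C : Set} (f : B → A → B) (g : C → List A) b xs →
    foldl f b (concatMap g xs) ≡ foldl (λ b x → foldl f b (g x)) b xs
  foldl-concatMap f g b []       = refl
  foldl-concatMap f g b (x ∷ xs) =
    trans (foldl-++ f b (g x) (concatMap g xs)) (foldl-concatMap f g (foldl f b (g x)) xs)

  -- `HasGeodesicCount S β` unfolds to an instance of this, so labels and the partial counts kept
  -- during the run are treated alike.
  HasCard : Pred A 0ℓ → ℕ → Set
  HasCard P k = ∃[ xs ] Unique xs × (∀ x → x ∈ xs ⇔ P x) × length xs ≡ k

  HasCard-resp : ∀ {P Q : Pred A 0ℓ} {k} → (∀ {x} → P x → Q x) → (∀ {x} → Q x → P x) →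
    HasCard P k → HasCard Q k
  HasCard-resp P⊆Q Q⊆P (xs , xs! , xs⇔P , len) =
    xs , xs! , (λ x → mk⇔ (P⊆Q ∘ to (xs⇔P x)) (from (xs⇔P x) ∘ Q⊆P)) , len

  HasCard-⊎ : ∀ {P Q : Pred A 0ℓ} {k m} → (∀ {x} → P x → ¬ Q x) →
    HasCard P k → HasCard Q m → HasCard (λ x → P x ⊎ Q x) (k ℕ.+ m)
  HasCard-⊎ P∩Q=∅ (xs , xs! , xs⇔P , lxs) (ys , ys! , ys⇔Q , lys) =
    xs ++ ys ,
    Unique.++⁺ xs! ys! (λ (z∈xs , z∈ys) → P∩Q=∅ (to (xs⇔P _) z∈xs) (to (ys⇔Q _) z∈ys)) ,
    (λ z → mk⇔
      ([ inj₁ ∘ to (xs⇔P z) , inj₂ ∘ to (ys⇔Q z) ]′ ∘ ∈-++⁻ xs)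
      [ ∈-++⁺ˡ ∘ from (xs⇔P z) , ∈-++⁺ʳ xs ∘ from (ys⇔Q z) ]′) ,
    trans (length-++ xs) (cong₂ ℕ._+_ lxs lys)

HasCard-image : ∀ {A B : Set} {P : Pred A 0ℓ} {k} {f : A → B} → (∀ {x y} → f x ≡ f y → x ≡ y) →
  HasCard P k → HasCard (λ y → ∃[ x ] y ≡ f x × P x) k
HasCard-image {f = f} f-inj (xs , xs! , xs⇔P , len) =
  map f xs , Unique.map⁺ f-inj xs! ,
  (λ y → mk⇔
    (λ y∈ → let (x , x∈ , y≡fx) = ∈-map⁻ f y∈ in x , y≡fx , to (xs⇔P x) x∈)
    (λ { (x , refl , Px) → ∈-map⁺ f (from (xs⇔P x) Px) })) ,
  trans (length-map f xs) len

-- Parity of braids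

-- The homomorphism from the braid group to Z/2 sending every `σ i` to 1, defined on group terms; an
-- inverse keeps its parity because each element of Z/2 is its own inverse.
braidParity : ∀ {n} → Braid n → Parity
braidParity (σ i)   = 1ℙ
braidParity ε       = 0ℙ
braidParity (x ∙ y) = braidParity x ℙ.+ braidParity y
braidParity (x ⁻¹)  = braidParity x

braidParity-cong : ∀ {n} {x y : Braid n} → x ≈ y → braidParity x ≡ braidParity y
braidParity-cong ≈-refl        = refl
braidParity-cong (≈-sym p)     = sym (braidParity-cong p)
braidParity-cong (≈-trans p q) = trans (braidParity-cong p) (braidParity-cong q)
braidParity-cong (∙-cong p q)  = cong₂ ℙ._+_ (braidParity-cong p) (braidParity-cong q)
braidParity-cong (⁻¹-cong p)   = braidParity-cong p
braidParity-cong (assoc x y z) = ℙ.+-assoc (braidParity x) (braidParity y) (braidParity z)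
braidParity-cong (identityˡ x) = refl
braidParity-cong (identityʳ x) = ℙ.+-identityʳ (braidParity x)
braidParity-cong (inverseˡ x)  = ℙ.p+p≡0ℙ (braidParity x)
braidParity-cong (inverseʳ x)  = ℙ.p+p≡0ℙ (braidParity x)
braidParity-cong (far i j _)   = refl
braidParity-cong (near i j _)  = refl

braidParity-^± : ∀ {n} (x : Braid n) s → braidParity (x ^± s) ≡ braidParity x
braidParity-^± x Sign.+ = refl
braidParity-^± x Sign.- = refl

braidParity-∏ : ∀ {n} {A : Set} (f : A → Braid n) → (∀ x → braidParity (f x) ≡ 1ℙ) →
  ∀ xs → braidParity (∏ (map f xs)) ≡ parity (length xs)
braidParity-∏ f f-odd []       = refl
braidParity-∏ f f-odd (x ∷ xs) =
  trans (cong₂ ℙ._+_ (f-odd x) (braidParity-∏ f f-odd xs)) (sym (ℙ.+-homo-+ 1 (length xs)))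

-- The two outer products have equally many factors, so their parities cancel and the middle `σ r`
-- remains.
conjugate-odd : ∀ {n} (is : List (Fin n)) r →
  braidParity {suc n} (∏ (map σ is) ∙ σ r ∙ ∏ (map (λ i → σ i ⁻¹) (reverse is))) ≡ 1ℙ
conjugate-odd {n} is r
  rewrite braidParity-∏ {suc n} σ (λ _ → refl) is
        | braidParity-∏ {suc n} (λ i → σ i ⁻¹) (λ _ → refl) (reverse is)
        | length-reverse is
  with parity (length is)
... | 0ℙ = refl
... | 1ℙ = refl

letter-odd : ∀ {S n} (x : Letter S n) → braidParity (letterBraid x) ≡ 1ℙ
letter-odd (σ± i s) = braidParity-^± (σ i) s
letter-odd {n = suc m} (a± p (suc r) p<q s) =
  trans (braidParity-^± (a p (suc r) p<q) s) (conjugate-odd between r)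
  where
  -- The list local to the definition of `a`, repeated here to instantiate `conjugate-odd`.
  between : List (Fin m)
  between = filter (λ i → (toℕ p ≤? toℕ i) ×-dec (toℕ i <? toℕ r)) (allFin m)

≋-parity : ∀ {S n} (u v : Word S n) → u ≋ v → parity (length u) ≡ parity (length v)
≋-parity u v u≋v = begin
  parity (length u)  ≡⟨ braidParity-∏ letterBraid letter-odd u ⟨
  braidParity ⟦ u ⟧  ≡⟨ braidParity-cong u≋v ⟩
  braidParity ⟦ v ⟧  ≡⟨ braidParity-∏ letterBraid letter-odd v ⟩
  parity (length v)  ∎
  where open ≡-Reasoning

-- Words and lengths

length-∷ʳ : ∀ {A : Set} (xs : List A) x → length (xs ∷ʳ x) ≡ suc (length xs)
length-∷ʳ xs x = trans (length-++-sucʳ xs x []) (cong (suc ∘ length) (++-identityʳ xs))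

invert : ∀ {S n} → Letter S n → Letter S n
invert (σ± i s)       = σ± i (Sign.opposite s)
invert (a± p q p<q s) = a± p q p<q (Sign.opposite s)

^±-opposite : ∀ {n} (x : Braid n) s → (x ^± s) ∙ (x ^± Sign.opposite s) ≈ ε
^±-opposite x Sign.+ = inverseʳ x
^±-opposite x Sign.- = inverseˡ x

invert-inverseʳ : ∀ {S n} (x : Letter S n) → letterBraid x ∙ letterBraid (invert x) ≈ ε
invert-inverseʳ (σ± i s)       = ^±-opposite (σ i) s
invert-inverseʳ (a± p q p<q s) = ^±-opposite (a p q p<q) s

⟦∷ʳ⟧ : ∀ {S n} (u : Word S n) x → ⟦ u ∷ʳ x ⟧ ≈ ⟦ u ⟧ ∙ letterBraid x
⟦∷ʳ⟧ []      x = ≈-trans (identityʳ _) (≈-sym (identityˡ _))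
⟦∷ʳ⟧ (y ∷ u) x = ≈-trans (∙-cong ≈-refl (⟦∷ʳ⟧ u x)) (≈-sym (assoc _ _ _))

∷ʳ-cong : ∀ {S n} (u v : Word S n) x → u ≋ v → (u ∷ʳ x) ≋ (v ∷ʳ x)
∷ʳ-cong u v x u≋v = ≈-trans (⟦∷ʳ⟧ u x) (≈-trans (∙-cong u≋v ≈-refl) (≈-sym (⟦∷ʳ⟧ v x)))

-- Cancelling the appended letter shows that one letter lowers the length of a braid by at most one.
∷ʳ-invert : ∀ {S n} (u v : Word S n) x → v ≋ (u ∷ʳ x) → (v ∷ʳ invert x) ≋ u
∷ʳ-invert u v x v≋ux =
  ≈-trans (⟦∷ʳ⟧ v (invert x)) (
  ≈-trans (∙-cong (≈-trans v≋ux (⟦∷ʳ⟧ u x)) ≈-refl) (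
  ≈-trans (assoc _ _ _) (
  ≈-trans (∙-cong ≈-refl (invert-inverseʳ x)) (identityʳ _))))

module _ {S : GeneratingSet} {n : ℕ} where

  HasLength-unique : ∀ {β : Braid n} {k m} → HasLength S β k → HasLength S β m → k ≡ m
  HasLength-unique ((u , u≈β , refl) , min₁) ((v , v≈β , refl) , min₂) =
    ≤-antisym (min₁ v v≈β) (min₂ u u≈β)

  HasLength-resp : ∀ {β γ : Braid n} {k} → β ≈ γ → HasLength S β k → HasLength S γ k
  HasLength-resp β≈γ ((u , u≈β , len) , min) =
    (u , ≈-trans u≈β β≈γ , len) , λ v v≈γ → min v (≈-trans v≈γ (≈-sym β≈γ))

  Geodesic-length : ∀ (u : Word S n) {β k} → Geodesic u → ⟦ u ⟧ ≈ β → HasLength S β k → length u ≡ k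
  Geodesic-length u g u≈β h = HasLength-unique g (HasLength-resp (≈-sym u≈β) h)

  -- A shorter word for the prefix, followed by `x`, would be a shorter word for the whole.
  Geodesic-init : ∀ (u : Word S n) x → Geodesic (u ∷ʳ x) → Geodesic u
  Geodesic-init u x (_ , min) = (u , ≈-refl , refl) , λ v v≋u →
    s≤s⁻¹ (≤-trans (≤-reflexive (sym (length-∷ʳ u x)))
          (≤-trans (min (v ∷ʳ x) (∷ʳ-cong v u x v≋u)) (≤-reflexive (length-∷ʳ v x))))

  -- Cancelling `x` forces every representative to have length at least `j`; length `j` is excluded
  -- by hypothesis and length `suc j` by parity.
  HasLength-∷ʳ : ∀ (u : Word S n) x {j} → length u ≡ suc j → HasLength S ⟦ u ⟧ (suc j) →
    ¬ HasLength S ⟦ u ∷ʳ x ⟧ j → HasLength S ⟦ u ∷ʳ x ⟧ (2 ℕ.+ j)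
  HasLength-∷ʳ u x {j} len (_ , min) ¬short = (u ∷ʳ x , ≈-refl , len′) , longer
    where
    len′ : length (u ∷ʳ x) ≡ 2 ℕ.+ j
    len′ = trans (length-∷ʳ u x) (cong suc len)

    bound : ∀ v → ⟦ v ⟧ ≈ ⟦ u ∷ʳ x ⟧ → j ≤ length v
    bound v v≋ux = s≤s⁻¹ (≤-trans (min (v ∷ʳ invert x) (∷ʳ-invert u v x v≋ux)) (≤-reflexive (length-∷ʳ v (invert x))))

    longer : ∀ v → ⟦ v ⟧ ≈ ⟦ u ∷ʳ x ⟧ → 2 ℕ.+ j ≤ length v
    longer v v≋ux with m≤n⇒m<n∨m≡n (bound v v≋ux)
    ... | inj₂ j≡v = ⊥-elim (¬short ((v , v≋ux , sym j≡v) , bound))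
    ... | inj₁ j<v with m≤n⇒m<n∨m≡n j<v
    ...   | inj₁ 1+j<v = 1+j<v
    -- The last but one equality holds because `parity (2 ℕ.+ j)` reduces to `parity j`.
    ...   | inj₂ 1+j≡v = ⊥-elim (ℙ.p≢p⁻¹ (parity (suc j)) (begin
      parity (suc j)            ≡⟨ cong parity 1+j≡v ⟩
      parity (length v)         ≡⟨ ≋-parity v (u ∷ʳ x) v≋ux ⟩
      parity (length (u ∷ʳ x))  ≡⟨ cong parity len′ ⟩
      parity j                  ≡⟨ ℙ.suc-homo-⁻¹ j ⟨
      parity (suc j) ℙ.⁻¹       ∎))
      where open ≡-Reasoning

-- The algorithm

module _ {S : GeneratingSet} {n : ℕ} (_≈?_ : Decidable (_≈_ {n})) where

  open Algorithm {S} _≈?_ using (record-word; body)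

  Entry : Set
  Entry = LabelledWord S n

  -- Updating the list of labelled words

  Separated : Rel Entry 0ℓ
  Separated e e′ = ¬ proj₁ e ≋ proj₁ e′

  -- Two predicates are needed because the meaning of a label changes when one more task has been
  -- executed.
  module _ {Q Q′ : Pred Entry 0ℓ} {v : Word S n} {k : ℕ}
           (hit  : ∀ {w m} → Q (w , m) → v ≋ w → Q′ (w , m ℕ.+ k))
           (miss : ∀ {e} → Q e → ¬ v ≋ proj₁ e → Q′ e) where

    -- After a hit the rest of the list is left untouched: separation is what makes it
    -- consist of misses.
    All-record-word : ∀ {W} → AllPairs Separated W →
      (All (λ e → ¬ v ≋ proj₁ e) W → Q′ (v , k)) → All Q W → All Q′ (record-word v k W)
    All-record-word {[]}          _        new []       = new [] ∷ []
    All-record-word {(w , m) ∷ W} (s ∷ ss) new (q ∷ qs) with ⟦ v ⟧ ≈? ⟦ w ⟧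
    ... | yes v≋w = hit q v≋w ∷
      All.zipWith (λ (q , w≉) → miss q (λ v≋ → w≉ (≈-trans (≈-sym v≋w) v≋))) (qs , s)
    ... | no  v≉w = miss q v≉w ∷ All-record-word ss (λ v≉W → new (v≉w ∷ v≉W)) qs

  record-word-separated : ∀ {v k W} → AllPairs Separated W → AllPairs Separated (record-word v k W)
  record-word-separated {v} {k} {[]}          _        = [] ∷ []
  record-word-separated {v} {k} {(w , m) ∷ W} (s ∷ ss) with ⟦ v ⟧ ≈? ⟦ w ⟧
  ... | yes _   = s ∷ ss
  ... | no  v≉w =
    -- The head must be inequivalent to the whole updated tail; the only possible new word there is
    -- `v`, which has just missed the head.
    All-record-word (λ w≉ _ → w≉) (λ w≉ _ → w≉) ss (λ _ w≋v → v≉w (≈-sym w≋v)) s ∷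
    record-word-separated ss

  -- `Q` sees words only, and an update may change a label but never a word already present.
  record-word-⊆ : ∀ {Q : Pred (Word S n) 0ℓ} {v k} W → Any (Q ∘ proj₁) W → Any (Q ∘ proj₁) (record-word v k W)
  record-word-⊆ {v = v} ((w , m) ∷ W) q with ⟦ v ⟧ ≈? ⟦ w ⟧
  record-word-⊆ (_ ∷ W) (here q)  | yes _ = here q
  record-word-⊆ (_ ∷ W) (there q) | yes _ = there q
  record-word-⊆ (_ ∷ W) (here q)  | no  _ = here q
  record-word-⊆ (_ ∷ W) (there q) | no  _ = there (record-word-⊆ W q)

  record-word-∋ : ∀ v k W → Any (λ e → v ≋ proj₁ e) (record-word v k W)
  record-word-∋ v k []            = here ≈-refl
  record-word-∋ v k ((w , m) ∷ W) with ⟦ v ⟧ ≈? ⟦ w ⟧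
  ... | yes v≋w = here v≋w
  ... | no  _   = there (record-word-∋ v k W)

  -- The loop invariant and its preservation

  module _ {j : ℕ} {W₁ : List Entry} {W₂ : List (Word S n)}
           (rep₁ : Represents (words W₁) (Sphere n S (suc j)))
           (rep₂ : Represents W₂ (Sphere n S j))
           (correct : All CorrectLabel W₁) where

    private
      module R₁ = Represents rep₁
      module R₂ = Represents rep₂

    Task : Set
    Task = Letter S n × Entry

    candidate : Task → Word S n
    candidate (x , u , k) = u ∷ʳ x

    step : List Entry → Task → List Entry
    step W (x , e) = body W₂ x W e

    -- Geodesicity is imposed on the prefix alone, so that a task contributes `k` words whatever the
    -- outcome of its test; that `w` is geodesic is recovered later from its length.
    Contributes : Task → Pred (Word S n) 0ℓ
    Contributes (x , u , k) w = ∃[ w′ ] w ≡ w′ ∷ʳ x × Geodesic w′ × w′ ≋ u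

    Contributed : List Task → Word S n → Pred (Word S n) 0ℓ
    Contributed P v w = Any (λ p → Contributes p w) P × w ≋ v

    -- Prefixes are compared up to equivalence because `Contributes` depends on `u` only through its
    -- braid.
    Apart : Rel Task 0ℓ
    Apart (x , u , _) (x′ , u′ , _) = ¬ (x ≡ x′ × u ≋ u′)

    contributes-≋ : ∀ p {w} → Contributes p w → w ≋ candidate p
    contributes-≋ (x , u , _) (w′ , refl , _ , w′≋u) = ∷ʳ-cong w′ u x w′≋u

    -- A word determines its last letter and its prefix, so a common contribution would identify the
    -- letters and the braids of the prefixes.
    apart-disjoint : ∀ p q {w} → Apart p q → Contributes p w → ¬ Contributes q w
    apart-disjoint p q p#q (w′ , refl , _ , w′≋u) (w″ , eq , _ , w″≋u″) with ∷ʳ-injective w′ w″ eq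
    ... | refl , refl = p#q (refl , ≈-trans (≈-sym w′≋u) w″≋u″)

    -- Appending `x` is injective, so the contributions are as numerous as the geodesics of the
    -- braid of `u`, which the input label counts.
    Contributes-card : ∀ {x u k} → (u , k) ∈ W₁ → HasCard (Contributes (x , u , k)) k
    Contributes-card e∈ = HasCard-image (∷ʳ-injectiveˡ _ _) (All.lookup correct e∈)

    -- `P` lists the executed tasks, latest first. `covered` serves twice: it shows that a newly
    -- added class has no earlier contributions, and at the end it gives surjectivity.
    record Invariant (P : List Task) (W : List Entry) : Set where
      field
        spherical : All (λ e → length (proj₁ e) ≡ 2 ℕ.+ j × HasLength S ⟦ proj₁ e ⟧ (2 ℕ.+ j)) W
        counted   : All (λ e → HasCard (Contributed P (proj₁ e)) (proj₂ e)) W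
        separated : AllPairs Separated W
        covered   : All (λ p → Any (candidate p ≋_) W₂ ⊎ Any (λ e → candidate p ≋ proj₁ e) W) P

    open Invariant

    W₂-short : ∀ v w → Any (v ≋_) W₂ → HasLength S ⟦ w ⟧ (2 ℕ.+ j) → ¬ v ≋ w
    W₂-short v w v∈ long v≋w with find v∈
    ... | (z , z∈ , v≋z) = 1+n≰n (≤-trans (n≤1+n _) (≤-reflexive
      (HasLength-unique long (HasLength-resp (≈-trans (≈-sym v≋z) v≋w) (R₂.into z∈)))))

    W₁-length : ∀ {u k} → (u , k) ∈ W₁ → length u ≡ suc j
    W₁-length e∈ = HasLength-unique (R₁.geodesic (∈-map⁺ proj₁ e∈)) (R₁.into (∈-map⁺ proj₁ e∈))

    -- Were the candidate of length `j`, surjectivity of `W₂` would provide an equivalent word and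
    -- the test would have succeeded.
    candidate-long : ∀ {x u k} → (u , k) ∈ W₁ → ¬ Any ((u ∷ʳ x) ≋_) W₂ →
      length (u ∷ʳ x) ≡ 2 ℕ.+ j × HasLength S ⟦ u ∷ʳ x ⟧ (2 ℕ.+ j)
    candidate-long {x} {u} e∈ v∉W₂ =
      trans (length-∷ʳ u x) (cong suc (W₁-length e∈)) ,
      HasLength-∷ʳ u x (W₁-length e∈) (R₁.into (∈-map⁺ proj₁ e∈)) λ short →
        let (z , z∈ , z≋v) = R₂.surjective short in v∉W₂ (lose z∈ (≈-sym z≋v))

    -- Every contribution of `p` is equivalent to its candidate, so none falls in the class of `w`.
    counted-skip : ∀ p w {P m} → ¬ candidate p ≋ w →
      HasCard (Contributed P w) m →
      HasCard (Contributed (p ∷ P) w) m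
    counted-skip p w v≉w = HasCard-resp
      (λ (c , w′≋w) → there c , w′≋w)
      λ { (here c  , w′≋w) → ⊥-elim (v≉w (≈-trans (≈-sym (contributes-≋ p c)) w′≋w))
        ; (there c , w′≋w) → c , w′≋w }

    invariant-step : ∀ {P W} p → proj₂ p ∈ W₁ → All (Apart p) P →
      Invariant P W → Invariant (p ∷ P) (step W p)
    invariant-step {P} {W} p@(x , u , k) e∈ p#P inv
      with any? (λ w → ⟦ u ∷ʳ x ⟧ ≈? ⟦ w ⟧) W₂
    -- The candidate has length `j` while all recorded words have length `2 ℕ.+ j`, so no count
    -- changes.
    ... | yes v∈W₂ = record
      { spherical = spherical inv
      ; counted   = All.zipWith (λ {e} ((_ , long) , card) →
                                   counted-skip p (proj₁ e) (W₂-short (u ∷ʳ x) (proj₁ e) v∈W₂ long) card)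
                                (spherical inv , counted inv)
      ; separated = separated inv
      ; covered   = inj₁ v∈W₂ ∷ covered inv
      }
    ... | no v∉W₂ = record
      { spherical = All-record-word (λ q _ → q) (λ q _ → q) (separated inv)
                      (λ _ → candidate-long e∈ v∉W₂) (spherical inv)
      ; counted   = All-record-word (λ {w} → merge w) (λ {e} card v≉w → counted-skip p (proj₁ e) v≉w card)
                      (separated inv) fresh (counted inv)
      ; separated = record-word-separated (separated inv)
      ; covered   = inj₂ (record-word-∋ v k W) ∷
                    All.map [ inj₁ , inj₂ ∘ record-word-⊆ W ]′ (covered inv)
      }
      where
      v : Word S n
      v = u ∷ʳ x

      merge : ∀ w {m} → HasCard (Contributed P w) m → v ≋ w →
              HasCard (Contributed (p ∷ P) w) (m ℕ.+ k)
      merge w card v≋w = HasCard-resp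
        [ (λ (c , w′≋w) → there c , w′≋w)
        , (λ c → here c , ≈-trans (contributes-≋ p c) v≋w) ]′
        (λ { (here c , _) → inj₂ c ; (there c , w′≋w) → inj₁ (c , w′≋w) })
        (HasCard-⊎ disjoint card (Contributes-card e∈))
        where
        disjoint : ∀ {w′} → Contributed P w w′ → ¬ Contributes p w′
        disjoint (c , _) cp = let (q , q∈ , cq) = find c in
          apart-disjoint p q (All.lookup p#P q∈) cp cq

      -- An earlier contribution to the class of `v` would come from a candidate equivalent to `v`.
      -- By `covered` that candidate matches a word of `W₂`, against the failed test, or of `W`,
      -- against `v≉W`.
      fresh : All (λ e → ¬ v ≋ proj₁ e) W → HasCard (Contributed (p ∷ P) v) k
      fresh v≉W = HasCard-resp
        (λ c → here c , contributes-≋ p c)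
        (λ { (here c , _) → c ; (there c , w≋v) → ⊥-elim (earlier c w≋v) })
        (Contributes-card e∈)
        where
        earlier : ∀ {w} → Any (λ q → Contributes q w) P → ¬ w ≋ v
        earlier c w≋v with find c
        ... | (q , q∈ , cq) = [ v∉W₂ ∘ Any.map (≈-trans v≋q) ,
                                (λ q≋W → let (e , e∈W , q≋e) = find q≋W in
                                   All.lookup v≉W e∈W (≈-trans v≋q q≋e)) ]′
                              (All.lookup (covered inv) q∈)
          where
          v≋q : v ≋ candidate q
          v≋q = ≈-trans (≈-sym w≋v) (contributes-≋ q cq)

    -- Executed tasks are pushed in front of `P`, whence `L ʳ++ P`. The pairwise relation is flipped
    -- because it is the later task that must be apart from the earlier one.
    invariant-foldl : ∀ {P W} L → All (λ p → proj₂ p ∈ W₁) L → All (λ p → All (Apart p) P) L →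
      AllPairs (λ p q → Apart q p) L → Invariant P W → Invariant (L ʳ++ P) (foldl step W L)
    invariant-foldl []      _         _         _        inv = inv
    invariant-foldl (p ∷ L) (e∈ ∷ L∈) (p# ∷ L#) (a ∷ as) inv =
      invariant-foldl L L∈ (All.zipWith (λ (q#p , q#P) → q#p ∷ q#P) (a , L#)) as
        (invariant-step p e∈ p# inv)

    -- The complete run in a given loop order

    module _ (order : LoopOrder W₁) where

      open LoopOrder order

      visits : Letter S n → List Task
      visits x = map (x ,_) (inner x)

      tasks : List Task
      tasks = concatMap visits letters

      RepSet-foldl : foldl step [] tasks ≡ RepSet _≈?_ W₁ W₂ order
      RepSet-foldl = trans (foldl-concatMap step visits [] letters)
        (foldl-cong (λ W x → foldl-map step (x ,_) W (inner x)) [] letters)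

      tasks-∈ : ∀ {p} → p ∈ tasks → proj₂ p ∈ W₁
      tasks-∈ p∈ with find (∈-concatMap⁻ visits {xs = letters} p∈)
      ... | (x , _ , p∈x) with ∈-map⁻ (x ,_) p∈x
      ...   | (e , e∈ , refl) = ∈-resp-↭ (inner-↭ x) e∈

      tasks-complete : ∀ x {e} → e ∈ W₁ → (x , e) ∈ tasks
      tasks-complete x e∈ = ∈-concatMap⁺ visits
        (lose (letters-complete x) (∈-map⁺ (x ,_) (∈-resp-↭ (↭-sym (inner-↭ x)) e∈)))

      -- Injectivity of the representation strengthens distinctness of words to inequivalence.
      W₁-separated : AllPairs Separated W₁
      W₁-separated = AllPairs.map⁻ (AllPairs-map-∈ (λ u∈ v∈ u≢v → u≢v ∘ R₁.injective u∈ v∈) R₁.unique)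

      -- Within one visit the prefixes are inequivalent, since `inner x` permutes `W₁`; tasks of
      -- different visits have different letters.
      tasks-apart : AllPairs (λ p q → Apart q p) tasks
      tasks-apart = AllPairs.concat⁺
        (All.map⁺ (All.universal (λ x → AllPairs.map⁺ (AllPairs.map (λ sep (_ , v≋u) → sep (≈-sym v≋u))
          (AllPairs-resp-↭ (λ sep → sep ∘ ≈-sym) (↭-sym (inner-↭ x)) W₁-separated))) letters))
        (AllPairs.map⁺ (AllPairs.map (λ x≢y →
          All.map⁺ (All.universal (λ _ → All.map⁺ (All.universal (λ _ (y≡x , _) → x≢y (sym y≡x)) _)) _))
          letters-unique))

      result : List Entry
      result = RepSet _≈?_ W₁ W₂ order

      result-invariant : Invariant (reverse tasks) result
      result-invariant = subst (Invariant _) RepSet-foldl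
        (invariant-foldl tasks (All.tabulate tasks-∈) (All.universal (λ _ → []) _) tasks-apart
          (record { spherical = [] ; counted = [] ; separated = [] ; covered = [] }))

      -- The prefix without the last letter is geodesic of length `suc j`, hence represented in
      -- `W₁`, and every letter is paired with every entry of `W₁`.
      geodesic-contributed : ∀ w → Geodesic w → length w ≡ 2 ℕ.+ j →
        ∃[ p ] p ∈ reverse tasks × Contributes p w
      geodesic-contributed w g len with initLast w
      ... | w′ ∷ʳ′ x with R₁.surjective (subst (HasLength S ⟦ w′ ⟧)
                            (suc-injective (trans (sym (length-∷ʳ w′ x)) len)) (Geodesic-init w′ x g))
      ...   | (u , u∈ , u≋w′) with ∈-map⁻ proj₁ u∈
      ...     | (e , e∈ , refl) =
        (x , e) , Any.reverse⁺ (tasks-complete x e∈) , w′ , refl , Geodesic-init w′ x g , ≈-sym u≋w′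

      contributed-length : ∀ {p w} → p ∈ reverse tasks → Contributes p w → length w ≡ 2 ℕ.+ j
      contributed-length p∈ (w′ , refl , g , w′≋u) = trans (length-∷ʳ w′ _)
        (cong suc (Geodesic-length w′ g w′≋u (R₁.into (∈-map⁺ proj₁ (tasks-∈ (Any.reverse⁻ p∈))))))

      result-represents : Represents (words result) (Sphere n S (2 ℕ.+ j))
      result-represents = record
        { unique     = AllPairs.map (λ { u≉v refl → u≉v ≈-refl }) words-separated
        ; geodesic   = λ u∈ → let (len , long) = lookup-spherical u∈ in
                         subst (HasLength S _) (sym len) long
        ; into       = proj₂ ∘ lookup-spherical
        ; injective  = AllPairs-¬⇒≡ ≈-sym words-separated
        ; surjective = surjective
        }
        where
        words-separated : AllPairs (λ u v → ¬ u ≋ v) (words result)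
        words-separated = AllPairs.map⁺ (separated result-invariant)

        lookup-spherical : ∀ {u} → u ∈ words result → length u ≡ 2 ℕ.+ j × HasLength S ⟦ u ⟧ (2 ℕ.+ j)
        lookup-spherical = All.lookup (All.map⁺ (spherical result-invariant))

        surjective : ∀ {β} → Sphere n S (2 ℕ.+ j) β → ∃[ u ] u ∈ words result × ⟦ u ⟧ ≈ β
        surjective {β} long@((w , w≈β , len) , _)
          with geodesic-contributed w
                 (subst (HasLength S ⟦ w ⟧) (sym len) (HasLength-resp (≈-sym w≈β) long)) len
        ... | (p , p∈ , c) with All.lookup (covered result-invariant) p∈
        -- A discarded candidate would give `β` length `j`.
        ...   | inj₁ v∈W₂ =
          ⊥-elim (W₂-short (candidate p) w v∈W₂ (HasLength-resp (≈-sym w≈β) long) (≈-sym (contributes-≋ p c)))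
        ...   | inj₂ v∈W with find v∈W
        ...     | (e , e∈ , v≋e) = proj₁ e , ∈-map⁺ proj₁ e∈ ,
          ≈-trans (≈-sym (≈-trans (contributes-≋ p c) v≋e)) w≈β

      -- After all tasks the contributed words of a recorded class are exactly its geodesics:
      -- `contributed-length` gives one inclusion, `geodesic-contributed` the other.
      result-labels : All CorrectLabel result
      result-labels = All.zipWith (λ {e} ((_ , long) , card) → HasCard-resp
          (λ (c , w≋e) → let (p , p∈ , cp) = find c in
            subst (HasLength S _) (sym (contributed-length p∈ cp)) (HasLength-resp (≈-sym w≋e) long) , w≋e)
          (λ {w} (g , w≋e) → let (p , p∈ , cp) = geodesic-contributed w g (Geodesic-length w g w≋e long) in
            lose p∈ cp , w≋e)
          card)
        (spherical result-invariant , counted result-invariant)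

proposition3p8 : (n : ℕ) → 2 ≤ n →
    (S : GeneratingSet) →
    (_≈?_ : Decidable (_≈_ {n})) →
    (ℓ : ℕ) → 2 ≤ ℓ →
    (W₁ : List (LabelledWord S n)) (W₂ : List (Word S n)) →
    Represents (words W₁) (Sphere n S (ℓ ∸ 1)) →
    Represents W₂ (Sphere n S (ℓ ∸ 2)) →
    All CorrectLabel W₁ →
    (order : LoopOrder W₁) →
    Represents (words (RepSet _≈?_ W₁ W₂ order)) (Sphere n S ℓ)
    × All CorrectLabel (RepSet _≈?_ W₁ W₂ order)
-- With ℓ written as `suc (suc j)`, the radii `ℓ ∸ 1` and `ℓ ∸ 2` reduce to `suc j` and `j`.
proposition3p8 n _ S _≈?_ (suc (suc j)) _ W₁ W₂ rep₁ rep₂ correct order =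
  result-represents _≈?_ rep₁ rep₂ correct order , result-labels _≈?_ rep₁ rep₂ correct order
proposition3p8 n _ S _≈?_ 1 (s≤s ()) W₁ W₂ rep₁ rep₂ correct order
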